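{- Let $b\ge2$, $s\ge1$, and $0\le u\le m$ be integers and let $\boldsymbol{e}=(e_1,\ldots,e_s)\in\mathbb{N}^s$ be an $s$-tuple of positive integers. Then any $(u,m,\boldsymbol{e},s)$-net in base $b$ is a $(t,m,s)$-net in base $b$ with $$t=\min\Big(u+\sum_{i=1}^s(e_i-1),\,m\Big).$$
   Context: Point sets are counted with multiplicity: for a point set $\mathcal{P}$ (finite indexed family), $A(J;\mathcal{P})$ is the number of indices $n$ with $\boldsymbol{x}_n\in J$. A *$(u,m,\boldsymbol{e},s)$-net in base $b$* is a point set $\mathcal{P}$ of $b^m$ points in $[0,1)^s$ such that $A(J;\mathcal{P})=b^m\,\mathrm{Vol}(J)$ for every interval $J=\prod_{i=1}^s[a_ib^{ -d_i},(a_i+1)b^{ -d_i})$ with integers $d_i\ge0$, $0\le a_i<b^{d_i}$, $e_i\mid d_i$ for $1\le i\le s$, and $\mathrm{Vol}(J)\ge b^{u-m}$. For integers $0\le t\le m$, a *$(t,m,s)$-net in base $b$* is a point set of $b^m$ points in $[0,1)^s$ such that every interval $\prod_{i=1}^s[a_ib^{ -d_i},(a_i+1)b^{ -d_i})$ with integers $d_i\ge0$, $0\le a_i<b^{d_i}$ and volume $b^{t-m}$ contains exactly $b^t$ of the points. -}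

module Defs where

open import Data.Fin.Base using (Fin; toℕ)
open import Data.Fin.Subset using (Subset; _∈_; ∣_∣)
open import Data.Integer.Base using (+_)
open import Data.Nat.Base as ℕ using (ℕ; suc; NonTrivial; nonTrivial⇒nonZero)
open import Data.Nat.Divisibility using (_∣_)
open import Data.Nat.Properties using (m^n≢0)
open import Data.Product.Base using (_×_; ∃-syntax)
open import Data.Rational.Base as ℚ using (ℚ; 0ℚ; 1ℚ; _/_)
import Data.Rational.Properties as ℚ
open import Data.Vec.Functional using (Vector)
open import Function.Bundles using (_⇔_)
open import Relation.Binary.PropositionalEquality using (_≡_; sym; subst; cong)

open import Algebra.Properties.CommutativeMonoid.Sum ℚ.*-1-commutativeMonoid using () renaming (sum to ∏)

-- Real numbers as Bishop's regular sequences of rationals, with the index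
-- shifted by one: the n-th term is within 1/(n+1) of the limit.

record ℝ : Set where
  field
    seq     : ℕ → ℚ
    regular : ∀ m n → ℚ.∣ seq m ℚ.- seq n ∣ ℚ.≤ (+ 1 / suc m) ℚ.+ (+ 1 / suc n)

open ℝ public

infix 4 _≤ᵣ_ _<ᵣ_

_≤ᵣ_ : ℝ → ℝ → Set
x ≤ᵣ y = ∀ n → seq x n ℚ.≤ seq y n ℚ.+ (+ 2 / suc n)

_<ᵣ_ : ℝ → ℝ → Set
x <ᵣ y = ∃[ n ] seq x n ℚ.+ (+ 2 / suc n) ℚ.< seq y n

fromℚ : ℚ → ℝ
fromℚ q .seq     _   = q
fromℚ q .regular m n = subst (ℚ._≤ bound) (sym (cong ℚ.∣_∣ (ℚ.+-inverseʳ q))) 0≤bound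
  where
  bound : ℚ
  bound = (+ 1 / suc m) ℚ.+ (+ 1 / suc n)

  0≤bound : 0ℚ ℚ.≤ bound
  0≤bound = ℚ.+-mono-≤ (ℚ.nonNegative⁻¹ (+ 1 / suc m) {{ℚ.normalize-nonNeg 1 (suc m)}})
                       (ℚ.nonNegative⁻¹ (+ 1 / suc n) {{ℚ.normalize-nonNeg 1 (suc n)}})

infix 4 _∈[_,_⟩

_∈[_,_⟩ : ℝ → ℚ → ℚ → Set
x ∈[ p , q ⟩ = (fromℚ p ≤ᵣ x) × (x <ᵣ fromℚ q)

fromℕ : ℕ → ℚ
fromℕ n = + n / 1

PointSet : ℕ → ℕ → Set
PointSet N s = Fin N → Vector ℝ s

InUnitCube : ∀ {N s} → PointSet N s → Set
InUnitCube P = ∀ n i → P n i ∈[ 0ℚ , 1ℚ ⟩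

module _ (b : ℕ) .{{_ : NonTrivial b}} where

  infix 8 _/b^_

  _/b^_ : ℕ → ℕ → ℚ
  a /b^ d = _/_ (+ a) (b ℕ.^ d) {{m^n≢0 b d {{nonTrivial⇒nonZero b}}}}

  record ElementaryInterval (s : ℕ) : Set where
    field
      d : Vector ℕ s
      a : ∀ i → Fin (b ℕ.^ d i)

    lower upper : Vector ℚ s
    lower i = toℕ (a i) /b^ d i
    upper i = suc (toℕ (a i)) /b^ d i

    Vol : ℚ
    Vol = ∏ (λ i → upper i ℚ.- lower i)

    Contains : Vector ℝ s → Set
    Contains x = ∀ i → x i ∈[ lower i , upper i ⟩

  open ElementaryInterval

  -- A(J;P) = k.  This is a relation rather than a function because the order
  -- on ℝ is not decidable; k is unique when it exists.
  Count : ∀ {N s} → ElementaryInterval s → PointSet N s → ℕ → Set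
  Count {N} J P k = ∃[ S ] (∀ (n : Fin N) → n ∈ S ⇔ Contains J (P n)) × ∣ S ∣ ≡ k

  -- The power b^(u-m), with a possibly negative exponent, is written b^u / b^m.
  record IsUNet (u m : ℕ) {s : ℕ} (e : Vector ℕ s) (P : PointSet (b ℕ.^ m) s) : Set where
    field
      inUnitCube : InUnitCube P
      equidistributed :
        (J : ElementaryInterval s) → (∀ i → e i ∣ d J i) →
        (b ℕ.^ u) /b^ m ℚ.≤ Vol J →
        ∃[ k ] Count J P k × fromℕ k ≡ fromℕ (b ℕ.^ m) ℚ.* Vol J

  record IsTNet (t m : ℕ) {s : ℕ} (P : PointSet (b ℕ.^ m) s) : Set where
    field
      t≤m        : t ℕ.≤ m
      inUnitCube : InUnitCube P
      equidistributed :
        (J : ElementaryInterval s) → Vol J ≡ (b ℕ.^ t) /b^ m →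
        Count J P (b ℕ.^ t)

{-# OPTIONS --safe #-}

-- Round every d i up to the next multiple of e i, at most e i ∸ 1 further.  An
-- interval of volume b^(t-m) is then a disjoint union of intervals on which the
-- hypothesis determines the number of points, and these numbers add up.  A real
-- number of the interval lies in one of the pieces only up to double negation,
-- since it cannot be compared with the rational end points; this suffices,
-- because membership in the counting subsets is decidable.  If t = m, the
-- interval is the whole cube and needs no rounding.

module Submission where

open import Defs
open import Data.Nat.Base using (ℕ; NonTrivial; _+_; _∸_; _^_; _⊓_; _≤_)
open import Data.Nat.Properties using (+-0-commutativeMonoid)
open import Data.Vec.Functional using (Vector)
open import Algebra.Properties.CommutativeMonoid.Sum +-0-commutativeMonoid using (sum)

open import Algebra.Properties.CommutativeMonoid.Sum +-0-commutativeMonoid using (∑-distrib-+; sum-replicate-zero)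
open import Data.Bool.Base using (true; false)
open import Data.Fin.Base using (Fin; zero; suc; toℕ; combine; cast)
import Data.Fin.Properties as Fin
open import Data.Fin.Subset using (Subset; _∈_; ∣_∣; _∪_) renaming (⊥ to ∅)
open import Data.Fin.Subset.Properties using (_∈?_; ∉⊥; ∣⊥∣≡0; ∪⇔⊎)
open import Data.Integer.Base as ℤ using (+_)
import Data.Integer.Properties as ℤ
open import Data.Nat.Base using (zero; suc; _*_; _<_; NonZero; z≤n; nonTrivial⇒nonZero; nonTrivial⇒n>1)
open import Data.Nat.Divisibility using (_∣_; divides; _∣0)
open import Data.Nat.DivMod using (_%_; m≡m%n+[m/n]*n; m%n<n)
import Data.Nat.DivMod as ℕ
import Data.Nat.Properties as ℕ
open import Data.Nat.Tactic.RingSolver using (solve-∀)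
open import Data.Product.Base using (_×_; _,_; proj₁; proj₂; ∃-syntax)
open import Data.Rational.Base as ℚ using (ℚ; _/_; toℚᵘ)
import Data.Rational.Properties as ℚ
open import Data.Rational.Unnormalised.Base as ℚᵘ using (*≡*; *≤*)
import Data.Rational.Unnormalised.Properties as ℚᵘ
open import Data.Sum.Base as Sum using (_⊎_; inj₁; inj₂; [_,_])
open import Data.Unit.Base using (⊤; tt)
open import Data.Vec using ([]; _∷_; here; there)
open import Function.Base using (_∘_)
open import Function.Bundles using (_⇔_; mk⇔; Equivalence)
open import Function.Construct.Composition using (_⇔-∘_)
open import Relation.Binary.Definitions using (tri<; tri≈; tri>)
open import Relation.Binary.PropositionalEquality
  using (_≡_; refl; sym; trans; cong; cong₂; subst; subst₂; module ≡-Reasoning)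
open import Relation.Nullary.Decidable using (yes; no; decidable-stable; ¬¬-excluded-middle)
open import Relation.Nullary.Negation using (¬_; contradiction; ¬¬-map)

open import Algebra.Properties.CommutativeMonoid.Sum ℕ.*-1-commutativeMonoid using () renaming (sum to ∏ℕ)
open import Algebra.Properties.CommutativeMonoid.Sum ℚ.*-1-commutativeMonoid using () renaming (sum to ∏)

open Equivalence using (to; from)

-- Fractions of natural numbers

toℚᵘ-/ : ∀ i n .{{_ : NonZero n}} → toℚᵘ (i / n) ℚᵘ.≃ i ℚᵘ./ n
toℚᵘ-/ i (suc n) = ℚ.toℚᵘ-fromℚᵘ (i ℚᵘ./ suc n)

-- `_/_` on ℚ reduces to lowest terms, so `p` and `m` cannot be read off from the quotient. In ℚᵘ
-- nothing is reduced and the order is cross multiplication by definition.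
/-mono-≤ : ∀ p q m n .{{_ : NonZero m}} .{{_ : NonZero n}} →
           p * n ≤ q * m → + p / m ℚ.≤ + q / n
/-mono-≤ p q m@(suc _) n@(suc _) pn≤qm = ℚ.toℚᵘ-cancel-≤ (begin
  toℚᵘ (+ p / m)  ≃⟨ toℚᵘ-/ (+ p) m ⟩
  + p ℚᵘ./ m      ≤⟨ *≤* (subst₂ ℤ._≤_ (ℤ.pos-* p n) (ℤ.pos-* q m) (ℤ.+≤+ pn≤qm)) ⟩
  + q ℚᵘ./ n      ≃⟨ toℚᵘ-/ (+ q) n ⟨
  toℚᵘ (+ q / n)  ∎)
  where open ℚᵘ.≤-Reasoning

/-cross : ∀ p q m n .{{_ : NonZero m}} .{{_ : NonZero n}} →
          p * n ≡ q * m → + p / m ≡ + q / n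
/-cross p q m n eq =
  ℚ.≤-antisym (/-mono-≤ p q m n (ℕ.≤-reflexive eq)) (/-mono-≤ q p n m (ℕ.≤-reflexive (sym eq)))

/-cross⁻¹ : ∀ p q m n .{{_ : NonZero m}} .{{_ : NonZero n}} →
            + p / m ≡ + q / n → p * n ≡ q * m
/-cross⁻¹ p q m@(suc m-1) n@(suc n-1) eq
  with *≡* pn≡qm ← ℚ./-injective-≃ (ℚᵘ.mkℚᵘ (+ p) m-1) (ℚᵘ.mkℚᵘ (+ q) n-1) eq =
  ℤ.+-injective (trans (ℤ.pos-* p n) (trans pn≡qm (sym (ℤ.pos-* q m))))

/-*-/ : ∀ p q m n .{{_ : NonZero m}} .{{_ : NonZero n}} .{{_ : NonZero (m * n)}} →
        (+ p / m) ℚ.* (+ q / n) ≡ + (p * q) / (m * n)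
/-*-/ p q m@(suc _) n@(suc _) = ℚ.toℚᵘ-injective (begin
  toℚᵘ ((+ p / m) ℚ.* (+ q / n))          ≈⟨ ℚ.toℚᵘ-homo-* (+ p / m) (+ q / n) ⟩
  toℚᵘ (+ p / m) ℚᵘ.* toℚᵘ (+ q / n)      ≈⟨ ℚᵘ.*-cong (toℚᵘ-/ (+ p) m) (toℚᵘ-/ (+ q) n) ⟩
  (+ p ℚᵘ./ m) ℚᵘ.* (+ q ℚᵘ./ n)          ≈⟨ *≡* (cong (ℤ._* + (m * n)) (sym (ℤ.pos-* p q))) ⟩
  + (p * q) ℚᵘ./ (m * n)                  ≈⟨ toℚᵘ-/ (+ (p * q)) (m * n) ⟨
  toℚᵘ (+ (p * q) / (m * n))              ∎)
  where open ℚᵘ.≃-Reasoning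

/-+-/ : ∀ p q n .{{_ : NonZero n}} → (+ p / n) ℚ.+ (+ q / n) ≡ + (p + q) / n
/-+-/ p q n@(suc _) = ℚ.toℚᵘ-injective (begin
  toℚᵘ ((+ p / n) ℚ.+ (+ q / n))      ≈⟨ ℚ.toℚᵘ-homo-+ (+ p / n) (+ q / n) ⟩
  toℚᵘ (+ p / n) ℚᵘ.+ toℚᵘ (+ q / n)  ≈⟨ ℚᵘ.+-cong (toℚᵘ-/ (+ p) n) (toℚᵘ-/ (+ q) n) ⟩
  (+ p ℚᵘ./ n) ℚᵘ.+ (+ q ℚᵘ./ n)      ≈⟨ *≡* cross ⟩
  + (p + q) ℚᵘ./ n                    ≈⟨ toℚᵘ-/ (+ (p + q)) n ⟨
  toℚᵘ (+ (p + q) / n)                ∎)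
  where
  open ℚᵘ.≃-Reasoning
  cross : (+ p ℤ.* + n ℤ.+ + q ℤ.* + n) ℤ.* + n ≡ + (p + q) ℤ.* + (n * n)
  cross = trans (cong (ℤ._* + n) (sym (ℤ.*-distribʳ-+ (+ n) (+ p) (+ q))))
         (trans (ℤ.*-assoc (+ (p + q)) (+ n) (+ n))
                (cong (+ (p + q) ℤ.*_) (sym (ℤ.pos-* n n))))

suc/-/ : ∀ a n .{{_ : NonZero n}} → (+ suc a / n) ℚ.- (+ a / n) ≡ + 1 / n
suc/-/ a n = begin
  (+ suc a / n) ℚ.- x            ≡⟨ cong (ℚ._- x) (/-+-/ 1 a n) ⟨
  ((+ 1 / n) ℚ.+ x) ℚ.- x        ≡⟨ ℚ.+-assoc (+ 1 / n) x (ℚ.- x) ⟩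
  (+ 1 / n) ℚ.+ (x ℚ.- x)        ≡⟨ cong ((+ 1 / n) ℚ.+_) (ℚ.+-inverseʳ x) ⟩
  (+ 1 / n) ℚ.+ ℚ.0ℚ             ≡⟨ ℚ.+-identityʳ (+ 1 / n) ⟩
  + 1 / n                        ∎
  where
  open ≡-Reasoning
  x = + a / n

-- Counting by decidable subsets

-- `Count b J P k` unfolds to an instance of this, with `Contains J (P n)` for `C n`. The subset `S`
-- carries a decision of `C`, which need not be decidable beforehand.
Counts : ∀ {N} → (Fin N → Set) → ℕ → Set
Counts {N} C k = ∃[ S ] (∀ (n : Fin N) → n ∈ S ⇔ C n) × ∣ S ∣ ≡ k

counts-cong : ∀ {N} {C D : Fin N → Set} {k} → (∀ n → C n ⇔ D n) → Counts C k → Counts D k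
counts-cong C⇔D (S , S⇔C , ∣S∣≡k) = S , (λ n → C⇔D n ⇔-∘ S⇔C n) , ∣S∣≡k

∣p∪q∣≡∣p∣+∣q∣ : ∀ {N} (p q : Subset N) → (∀ {n} → n ∈ p → ¬ (n ∈ q)) → ∣ p ∪ q ∣ ≡ ∣ p ∣ + ∣ q ∣
∣p∪q∣≡∣p∣+∣q∣ []          []          _        = refl
∣p∪q∣≡∣p∣+∣q∣ (false ∷ p) (false ∷ q) disjoint = ∣p∪q∣≡∣p∣+∣q∣ p q (λ n∈p n∈q → disjoint (there n∈p) (there n∈q))
∣p∪q∣≡∣p∣+∣q∣ (false ∷ p) (true ∷ q)  disjoint =
  trans (cong suc (∣p∪q∣≡∣p∣+∣q∣ p q (λ n∈p n∈q → disjoint (there n∈p) (there n∈q))))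
        (sym (ℕ.+-suc ∣ p ∣ ∣ q ∣))
∣p∪q∣≡∣p∣+∣q∣ (true ∷ p)  (false ∷ q) disjoint =
  cong suc (∣p∪q∣≡∣p∣+∣q∣ p q (λ n∈p n∈q → disjoint (there n∈p) (there n∈q)))
∣p∪q∣≡∣p∣+∣q∣ (true ∷ p)  (true ∷ q)  disjoint = contradiction here (disjoint here)

counts-⊎ : ∀ {N} {C D : Fin N → Set} {k l} → (∀ {n} → C n → ¬ D n) →
           Counts C k → Counts D l → Counts (λ n → C n ⊎ D n) (k + l)
counts-⊎ disjoint (S , S⇔C , refl) (T , T⇔D , refl) =
  S ∪ T
  , (λ n → mk⇔ (Sum.map (to (S⇔C n)) (to (T⇔D n)) ∘ to ∪⇔⊎)
               (from ∪⇔⊎ ∘ Sum.map (from (S⇔C n)) (from (T⇔D n))))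
  , ∣p∪q∣≡∣p∣+∣q∣ S T (λ {n} n∈S n∈T → disjoint (to (S⇔C n) n∈S) (to (T⇔D n) n∈T))

counts-∃ : ∀ {N B k} {D : Fin B → Fin N → Set} →
           (∀ {i j n} → D i n → D j n → i ≡ j) → (∀ j → Counts (D j) k) →
           Counts (λ n → ∃[ j ] D j n) (B * k)
counts-∃ {N} {zero}  _        _      =
  ∅ , (λ n → mk⇔ (λ n∈∅ → contradiction n∈∅ ∉⊥) (λ ())) , ∣⊥∣≡0 N
counts-∃ {N} {suc B} disjoint counts =
  counts-cong (λ n → mk⇔ [ zero ,_ , (λ (j , Dj) → suc j , Dj) ]
                         (λ { (zero , D₀) → inj₁ D₀ ; (suc j , Dj) → inj₂ (j , Dj) }))
    (counts-⊎ (λ D₀ (j , Dj) → Fin.0≢1+n (disjoint D₀ Dj))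
      (counts zero)
      (counts-∃ (λ Di Dj → Fin.suc-injective (disjoint Di Dj)) (counts ∘ suc)))

record IsPartition {X : Set} {B : ℕ} (C : X → Set) (D : Fin B → X → Set) : Set where
  field
    sub      : ∀ {j x} → D j x → C x
    disjoint : ∀ {i j x} → D i x → D j x → i ≡ j
    cover    : ∀ {x} → C x → ¬ ¬ (∃[ j ] D j x)

open IsPartition

-- Pulls a partition of an interval of reals back to the point indices, along the coordinate map
-- from `n` to `P n i`.
partition-∘ : ∀ {X Y : Set} {B} {C : X → Set} {D : Fin B → X → Set} (f : Y → X) →
              IsPartition C D → IsPartition (C ∘ f) (λ j → D j ∘ f)
partition-∘ f part .sub {j} {y}          = sub part {j} {f y}
partition-∘ f part .disjoint {i} {j} {y} = disjoint part {i} {j} {f y}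
partition-∘ f part .cover {y}            = cover part {f y}

counts-partition : ∀ {N B k} {C : Fin N → Set} {D : Fin B → Fin N → Set} →
                   IsPartition C D → (∀ j → Counts (D j) k) → Counts C (B * k)
counts-partition part counts with S , S⇔D , ∣S∣ ← counts-∃ (disjoint part) counts =
  S
  , (λ n → mk⇔ (sub part ∘ proj₂ ∘ to (S⇔D n))
               -- `cover` places `n` in some piece only under a double negation; membership in `S`
               -- is decidable, hence stable.
               (λ Cn → decidable-stable (n ∈? S) (¬¬-map (from (S⇔D n)) (cover part Cn))))
  , ∣S∣

-- E accumulates the coordinates that are already refined in the induction on s.
counts-box : ∀ {N k} s {B : Vector ℕ s} {C : Fin s → Fin N → Set}
             {D : ∀ i → Fin (B i) → Fin N → Set} {E : Fin N → Set} →
             (∀ i → IsPartition (C i) (D i)) →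
             (∀ (j : ∀ i → Fin (B i)) → Counts (λ n → E n × (∀ i → D i (j i) n)) k) →
             Counts (λ n → E n × (∀ i → C i n)) (∏ℕ B * k)
counts-box {k = k} zero    part counts =
  -- The empty product is 1, and `1 * k` reduces to `k + 0`.
  subst (Counts _) (sym (ℕ.+-identityʳ k))
    (counts-cong (λ n → mk⇔ (λ (En , _) → En , λ ()) (λ (En , _) → En , λ ())) (counts (λ ())))
counts-box {k = k} (suc s) {B} {C} {D} {E} part counts =
  subst (Counts _) (sym (ℕ.*-assoc (B zero) (∏ℕ (B ∘ suc)) k))
    -- Cut along the first coordinate into `B zero` slabs. The induction hypothesis counts each
    -- slab, with the condition `D zero j₀` moved into `E`.
    (counts-partition part₀ λ j₀ →
      counts-box s {E = λ n → E n × D zero j₀ n} (part ∘ suc) λ j →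
        counts-cong (λ n → mk⇔ (λ (En , Dn) → (En , Dn zero) , Dn ∘ suc)
                               (λ ((En , D₀) , Dn) → En , λ { zero → D₀ ; (suc i) → Dn i }))
          (counts λ { zero → j₀ ; (suc i) → j i }))
  where
  part₀ : IsPartition (λ n → E n × (∀ i → C i n))
                      (λ j₀ n → (E n × D zero j₀ n) × (∀ i → C (suc i) n))
  part₀ .sub ((En , D₀) , Cn) = En , λ { zero → sub (part zero) D₀ ; (suc i) → Cn i }
  part₀ .disjoint ((_ , Di) , _) ((_ , Dj) , _) = disjoint (part zero) Di Dj
  part₀ .cover (En , Cn) = ¬¬-map (λ (j , D₀) → j , (En , D₀) , Cn ∘ suc) (cover (part zero) (Cn zero))

-- Subdivision of an interval of reals

-- Both relations allow the same slack `2/(n+1)`, so refuting the existential gives, at each `n`,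
-- exactly the rational inequality required.
≮ᵣ⇒≥ᵣ : ∀ x q → ¬ (x <ᵣ fromℚ q) → fromℚ q ≤ᵣ x
≮ᵣ⇒≥ᵣ x q x≮q n = ℚ.≮⇒≥ (λ x<q → x≮q (n , x<q))

<ᵣ⇒≱ᵣ : ∀ x q → x <ᵣ fromℚ q → ¬ (fromℚ q ≤ᵣ x)
<ᵣ⇒≱ᵣ x q (n , x<q) q≤x = ℚ.<-irrefl refl (ℚ.<-≤-trans x<q (q≤x n))

≤-≤ᵣ-trans : ∀ {p q} x → p ℚ.≤ q → fromℚ q ≤ᵣ x → fromℚ p ≤ᵣ x
≤-≤ᵣ-trans x p≤q q≤x n = ℚ.≤-trans p≤q (q≤x n)

<ᵣ-≤-trans : ∀ {p q} x → x <ᵣ fromℚ p → p ℚ.≤ q → x <ᵣ fromℚ q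
<ᵣ-≤-trans x (n , x<p) p≤q = n , ℚ.<-≤-trans x<p p≤q

-- Induction on the number of cells: either `x` is below `g 1` and lies in the first cell, or the
-- rest of the grid remains. The goal is a negation, so this comparison may be assumed decided.
grid-cover : ∀ B (g : ℕ → ℚ) x → x ∈[ g 0 , g B ⟩ →
             ¬ ¬ (∃[ j ] x ∈[ g (toℕ {B} j) , g (suc (toℕ j)) ⟩)
grid-cover zero    g x (g₀≤x , x<g₀) _ = <ᵣ⇒≱ᵣ x (g 0) x<g₀ g₀≤x
grid-cover (suc B) g x (g₀≤x , x<g) none = ¬¬-excluded-middle {A = x <ᵣ fromℚ (g 1)} λ
  { (yes x<g₁) → none (zero , g₀≤x , x<g₁)
  ; (no  x≮g₁) → grid-cover B (g ∘ suc) x (≮ᵣ⇒≥ᵣ x (g 1) x≮g₁ , x<g) (λ (j , x∈) → none (suc j , x∈))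
  }

grid-partition : ∀ B (g : ℕ → ℚ) → (∀ {i j} → i ≤ j → g i ℚ.≤ g j) →
                 IsPartition (_∈[ g 0 , g B ⟩) (λ (j : Fin B) → _∈[ g (toℕ j) , g (suc (toℕ j)) ⟩)
grid-partition B g mono .sub {j} {x} (l , u) =
  ≤-≤ᵣ-trans {g 0} {g (toℕ j)} x (mono z≤n) l , <ᵣ-≤-trans {g (suc (toℕ j))} {g B} x u (mono (Fin.toℕ<n j))
grid-partition B g mono .disjoint {i} {j} {x} (lᵢ , uᵢ) (lⱼ , uⱼ) with Fin.<-cmp i j
... | tri< i<j _ _ =
  contradiction lⱼ (<ᵣ⇒≱ᵣ x (g (toℕ j)) (<ᵣ-≤-trans {g (suc (toℕ i))} {g (toℕ j)} x uᵢ (mono i<j)))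
... | tri≈ _ i≡j _ = i≡j
... | tri> _ _ j<i =
  contradiction lᵢ (<ᵣ⇒≱ᵣ x (g (toℕ i)) (<ᵣ-≤-trans {g (suc (toℕ j))} {g (toℕ i)} x uⱼ (mono j<i)))
grid-partition B g mono .cover {x} = grid-cover B g x

-- Elementary intervals

round-up : ∀ d e → 1 ≤ e → ∃[ c ] (e ∣ d + c) × c ≤ e ∸ 1
-- Here `e` is one less than the modulus. The least multiple of `suc e` that is at least `d` is the
-- greatest one that is at most `d + e`, namely `n ∸ r`.
round-up d (suc e) _ = e ∸ r , divides (n ℕ./ suc e) eq , ℕ.m∸n≤m e r
  where
  n = d + e
  r = n % suc e
  r≤e : r ≤ e
  r≤e = ℕ.≤-pred (m%n<n n (suc e))
  eq : d + (e ∸ r) ≡ n ℕ./ suc e * suc e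
  eq = begin
    d + (e ∸ r)                    ≡⟨ ℕ.+-∸-assoc d r≤e ⟨
    n ∸ r                          ≡⟨ cong (_∸ r) (m≡m%n+[m/n]*n n (suc e)) ⟩
    r + n ℕ./ suc e * suc e ∸ r    ≡⟨ ℕ.m+n∸m≡n r _ ⟩
    n ℕ./ suc e * suc e            ∎
    where open ≡-Reasoning

sum-mono-≤ : ∀ {s} {f g : Vector ℕ s} → (∀ i → f i ≤ g i) → sum f ≤ sum g
sum-mono-≤ {zero}  f≤g = z≤n
sum-mono-≤ {suc s} f≤g = ℕ.+-mono-≤ (f≤g zero) (sum-mono-≤ (f≤g ∘ suc))

sum≡0⇒≡0 : ∀ {s} (f : Vector ℕ s) → sum f ≡ 0 → ∀ i → f i ≡ 0
sum≡0⇒≡0 f eq zero    = ℕ.m+n≡0⇒m≡0 (f zero) eq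
sum≡0⇒≡0 f eq (suc i) = sum≡0⇒≡0 (f ∘ suc) (ℕ.m+n≡0⇒n≡0 (f zero) eq) i

∏-^ : ∀ b {s} (c : Vector ℕ s) → ∏ℕ (λ i → b ^ c i) ≡ b ^ sum c
∏-^ b {zero}  c = refl
∏-^ b {suc s} c = trans (cong (b ^ c zero *_) (∏-^ b (c ∘ suc)))
                        (sym (ℕ.^-distribˡ-+-* b (c zero) (sum (c ∘ suc))))

^-injectiveʳ : ∀ b → 1 < b → ∀ {i j} → b ^ i ≡ b ^ j → i ≡ j
^-injectiveʳ b 1<b {i} {j} eq with ℕ.<-cmp i j
... | tri< i<j _ _ = contradiction eq (ℕ.<⇒≢ (ℕ.^-monoʳ-< b 1<b i<j))
... | tri≈ _ i≡j _ = i≡j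
... | tri> _ _ j<i = contradiction (sym eq) (ℕ.<⇒≢ (ℕ.^-monoʳ-< b 1<b j<i))

open ElementaryInterval

module _ (b : ℕ) .{{_ : NonTrivial b}} where

  infix 8 _/ᵇ_

  _/ᵇ_ : ℕ → ℕ → ℚ
  a /ᵇ d = (b /b^ a) d

  b^≢0 : ∀ d → NonZero (b ^ d)
  b^≢0 d = ℕ.m^n≢0 b d {{nonTrivial⇒nonZero b}}

  /ᵇ-mono-≤ : ∀ p q k l → p * b ^ l ≤ q * b ^ k → p /ᵇ k ℚ.≤ q /ᵇ l
  /ᵇ-mono-≤ p q k l = /-mono-≤ p q (b ^ k) (b ^ l) {{b^≢0 k}} {{b^≢0 l}}

  /ᵇ-cross : ∀ p q k l → p * b ^ l ≡ q * b ^ k → p /ᵇ k ≡ q /ᵇ l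
  /ᵇ-cross p q k l = /-cross p q (b ^ k) (b ^ l) {{b^≢0 k}} {{b^≢0 l}}

  /ᵇ-cross⁻¹ : ∀ p q k l → p /ᵇ k ≡ q /ᵇ l → p * b ^ l ≡ q * b ^ k
  /ᵇ-cross⁻¹ p q k l = /-cross⁻¹ p q (b ^ k) (b ^ l) {{b^≢0 k}} {{b^≢0 l}}

  /ᵇ-*-/ᵇ : ∀ p q k l → p /ᵇ k ℚ.* q /ᵇ l ≡ (p * q) /ᵇ (k + l)
  /ᵇ-*-/ᵇ p q k l =
    trans (/-*-/ p q (b ^ k) (b ^ l) {{b^≢0 k}} {{b^≢0 l}} {{nz}})
          (/-cross (p * q) (p * q) (b ^ k * b ^ l) (b ^ (k + l)) {{nz}} {{b^≢0 (k + l)}}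
            (cong (p * q *_) (ℕ.^-distribˡ-+-* b k l)))
    where
    nz : NonZero (b ^ k * b ^ l)
    nz = ℕ.m*n≢0 (b ^ k) (b ^ l) {{b^≢0 k}} {{b^≢0 l}}

  ∏-unit-fractions : ∀ {s} (d a : Vector ℕ s) →
                     ∏ (λ i → suc (a i) /ᵇ d i ℚ.- a i /ᵇ d i) ≡ 1 /ᵇ sum d
  ∏-unit-fractions {zero}  d a = refl
  ∏-unit-fractions {suc s} d a = begin
    (suc (a zero) /ᵇ d zero ℚ.- a zero /ᵇ d zero)
      ℚ.* ∏ (λ i → suc (a (suc i)) /ᵇ d (suc i) ℚ.- a (suc i) /ᵇ d (suc i))
      ≡⟨ cong₂ ℚ._*_ (suc/-/ (a zero) (b ^ d zero) {{b^≢0 (d zero)}}) (∏-unit-fractions (d ∘ suc) (a ∘ suc)) ⟩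
    1 /ᵇ d zero ℚ.* 1 /ᵇ sum (d ∘ suc)
      ≡⟨ /ᵇ-*-/ᵇ 1 1 (d zero) (sum (d ∘ suc)) ⟩
    1 /ᵇ sum d ∎
    where open ≡-Reasoning

  -- Side `i` has length `b^(-d i)` wherever the interval lies, so conditions on the volume become
  -- conditions on the sum of the exponents.
  Vol≡ : ∀ {s} (J : ElementaryInterval b s) → Vol J ≡ 1 /ᵇ sum (d J)
  Vol≡ J = ∏-unit-fractions (d J) (toℕ ∘ a J)

  -- Subdivision of an elementary interval into congruent boxes

  subinterval : ∀ {s} (J : ElementaryInterval b s) (c : Vector ℕ s) →
                (∀ i → Fin (b ^ c i)) → ElementaryInterval b s
  subinterval J c j .d i = d J i + c i
  -- `combine` yields `b ^ c i * a + j`: the base-`b` expansion of `a` is extended by the `c i`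
  -- digits of `j`.
  subinterval J c j .a i = cast (sym (ℕ.^-distribˡ-+-* b (d J i) (c i))) (combine (a J i) (j i))

  module _ {N s} (P : PointSet N s) (J : ElementaryInterval b s) (c : Vector ℕ s) where

    -- The end points of all pieces as one function on ℕ, the form that `grid-partition` takes;
    -- index `b ^ c i` is the right end of the whole side.
    grid : Fin s → ℕ → ℚ
    grid i k = (b ^ c i * toℕ (a J i) + k) /ᵇ (d J i + c i)

    grid-mono : ∀ i {k l} → k ≤ l → grid i k ℚ.≤ grid i l
    grid-mono i {k} {l} k≤l =
      /ᵇ-mono-≤ (b ^ c i * toℕ (a J i) + k) (b ^ c i * toℕ (a J i) + l) (d J i + c i) (d J i + c i)
        (ℕ.*-monoˡ-≤ (b ^ (d J i + c i)) (ℕ.+-monoʳ-≤ (b ^ c i * toℕ (a J i)) k≤l))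

    lower≡grid : ∀ i → lower J i ≡ grid i 0
    lower≡grid i = /ᵇ-cross (toℕ (a J i)) (b ^ c i * toℕ (a J i) + 0) (d J i) (d J i + c i)
      (trans (cong (toℕ (a J i) *_) (ℕ.^-distribˡ-+-* b (d J i) (c i)))
             (shuffle (toℕ (a J i)) (b ^ d J i) (b ^ c i)))
      where
      shuffle : ∀ x y z → x * (y * z) ≡ (z * x + 0) * y
      shuffle = solve-∀

    upper≡grid : ∀ i → upper J i ≡ grid i (b ^ c i)
    upper≡grid i = /ᵇ-cross (suc (toℕ (a J i))) (b ^ c i * toℕ (a J i) + b ^ c i) (d J i) (d J i + c i)
      (trans (cong (suc (toℕ (a J i)) *_) (ℕ.^-distribˡ-+-* b (d J i) (c i)))
             (shuffle (toℕ (a J i)) (b ^ d J i) (b ^ c i)))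
      where
      shuffle : ∀ x y z → (1 + x) * (y * z) ≡ (z * x + z) * y
      shuffle = solve-∀

    module _ (j : ∀ i → Fin (b ^ c i)) where

      toℕ-a : ∀ i → toℕ (a (subinterval J c j) i) ≡ b ^ c i * toℕ (a J i) + toℕ (j i)
      toℕ-a i = trans (Fin.toℕ-cast _ (combine (a J i) (j i))) (Fin.toℕ-combine (a J i) (j i))

      sublower≡grid : ∀ i → lower (subinterval J c j) i ≡ grid i (toℕ (j i))
      sublower≡grid i = cong (λ k → k /ᵇ (d J i + c i)) (toℕ-a i)

      subupper≡grid : ∀ i → upper (subinterval J c j) i ≡ grid i (suc (toℕ (j i)))
      subupper≡grid i = cong (λ k → k /ᵇ (d J i + c i))
        (trans (cong suc (toℕ-a i)) (sym (ℕ.+-suc (b ^ c i * toℕ (a J i)) (toℕ (j i)))))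

    count-subdivide : ∀ {k} → (∀ j → Count b (subinterval J c j) P k) → Count b J P (b ^ sum c * k)
    count-subdivide {k} counts =
      subst (λ B → Count b J P (B * k)) (∏-^ b c)
        (counts-cong
          (λ n → mk⇔ (λ (_ , x∈) i → subst₂ (P n i ∈[_,_⟩) (sym (lower≡grid i)) (sym (upper≡grid i)) (x∈ i))
                     (λ x∈ → tt , λ i → subst₂ (P n i ∈[_,_⟩) (lower≡grid i) (upper≡grid i) (x∈ i)))
          -- At the start no coordinate has been refined, so the accumulated condition is trivial.
          (counts-box s {E = λ _ → ⊤} cells
            (λ j → counts-cong
              (λ n → mk⇔ (λ x∈ → tt , λ i → subst₂ (P n i ∈[_,_⟩) (sublower≡grid j i) (subupper≡grid j i) (x∈ i))
                         (λ (_ , x∈) i → subst₂ (P n i ∈[_,_⟩) (sym (sublower≡grid j i)) (sym (subupper≡grid j i)) (x∈ i)))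
              (counts j))))
      where
      cells : ∀ i → IsPartition (λ n → P n i ∈[ grid i 0 , grid i (b ^ c i) ⟩)
                          (λ (j : Fin (b ^ c i)) n → P n i ∈[ grid i (toℕ j) , grid i (suc (toℕ j)) ⟩)
      cells i = partition-∘ (λ n → P n i) (grid-partition (b ^ c i) (grid i) (grid-mono i))

  -- Point counts of a net

  module _ {u m s} {e : Vector ℕ s} {P : PointSet (b ^ m) s} (net : IsUNet b u m e P) where

    open IsUNet net

    -- The last hypothesis says that `J` has volume `b^(l-m)`. As `u ≤ l`, this is large enough for
    -- the net property, which prescribes `b^m * b^(l-m)` points.
    count-divisible : ∀ (J : ElementaryInterval b s) l → (∀ i → e i ∣ d J i) →
                      u ≤ l → l + sum (d J) ≡ m → Count b J P (b ^ l)
    count-divisible J l e∣d u≤l eq =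
      let k , count , k≡ = equidistributed J e∣d large
      in subst (Count b J P) (k≡b^l k k≡) count
      where
      D = sum (d J)

      b^l*b^D≡b^m : b ^ l * b ^ D ≡ b ^ m
      b^l*b^D≡b^m = trans (sym (ℕ.^-distribˡ-+-* b l D)) (cong (b ^_) eq)

      large : (b ^ u) /ᵇ m ℚ.≤ Vol J
      large = subst ((b ^ u) /ᵇ m ℚ.≤_) (sym (Vol≡ J)) (/ᵇ-mono-≤ (b ^ u) 1 m D (begin
        b ^ u * b ^ D  ≤⟨ ℕ.*-monoˡ-≤ (b ^ D) (ℕ.^-monoʳ-≤ b {{nonTrivial⇒nonZero b}} u≤l) ⟩
        b ^ l * b ^ D  ≡⟨ b^l*b^D≡b^m ⟩
        b ^ m          ≡⟨ ℕ.*-identityˡ (b ^ m) ⟨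
        1 * b ^ m      ∎))
        where open ℕ.≤-Reasoning

      k≡b^l : ∀ k → fromℕ k ≡ fromℕ (b ^ m) ℚ.* Vol J → k ≡ b ^ l
      k≡b^l k k≡ = ℕ.*-cancelʳ-≡ k (b ^ l) (b ^ D) {{b^≢0 D}} (begin
        k * b ^ D        ≡⟨ /ᵇ-cross⁻¹ k (b ^ m * 1) 0 D k/1≡ ⟩
        b ^ m * 1 * 1    ≡⟨ ℕ.*-identityʳ (b ^ m * 1) ⟩
        b ^ m * 1        ≡⟨ ℕ.*-identityʳ (b ^ m) ⟩
        b ^ m            ≡⟨ b^l*b^D≡b^m ⟨
        b ^ l * b ^ D    ∎)
        where
        open ≡-Reasoning
        -- `fromℕ k` is `k /ᵇ 0` by computation, since `b ^ 0` reduces to 1; this brings both sides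
        -- to fractions over powers of `b`.
        k/1≡ : k /ᵇ 0 ≡ (b ^ m * 1) /ᵇ D
        k/1≡ = trans k≡ (trans (cong (fromℕ (b ^ m) ℚ.*_) (Vol≡ J)) (/ᵇ-*-/ᵇ (b ^ m) 1 0 D))

    -- Refining by `c` gives `b ^ sum c` pieces of volume `b^(t - sum c - m)`. The bound on `t` says
    -- `u ≤ t ∸ sum c`, so each piece holds `b ^ (t ∸ sum c)` points, and the product is `b ^ t`.
    count-roundable : ∀ (J : ElementaryInterval b s) c t → (∀ i → e i ∣ d J i + c i) →
                      u + sum c ≤ t → t + sum (d J) ≡ m → Count b J P (b ^ t)
    count-roundable J c t e∣d+c u+c≤t eq =
      subst (Count b J P) (trans (sym (ℕ.^-distribˡ-+-* b (sum c) (t ∸ sum c)))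
                                 (cong (b ^_) (ℕ.m+[n∸m]≡n c≤t)))
        (count-subdivide P J c λ j → count-divisible (subinterval J c j) (t ∸ sum c) e∣d+c
         (ℕ.m+n≤o⇒m≤o∸n u u+c≤t) (begin
          t ∸ sum c + sum (λ i → d J i + c i)    ≡⟨ cong (λ n → t ∸ sum c + n) (∑-distrib-+ (d J) c) ⟩
          t ∸ sum c + (sum (d J) + sum c)        ≡⟨ cong (λ n → t ∸ sum c + n) (ℕ.+-comm (sum (d J)) (sum c)) ⟩
          t ∸ sum c + (sum c + sum (d J))        ≡⟨ ℕ.+-assoc (t ∸ sum c) (sum c) (sum (d J)) ⟨
          t ∸ sum c + sum c + sum (d J)          ≡⟨ cong (_+ sum (d J)) (ℕ.m∸n+n≡m c≤t) ⟩
          t + sum (d J)                          ≡⟨ eq ⟩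
          m                                      ∎))
      where
      open ≡-Reasoning
      c≤t : sum c ≤ t
      c≤t = ℕ.≤-trans (ℕ.m≤n+m (sum c) u) u+c≤t

  -- Clearing denominators in `1/b^D = b^t/b^m`, with `D` the sum of the `d J i`, equates two powers
  -- of `b`; the exponents agree because `b > 1`.
  Vol≡b^t/b^m⇒t+d≡m : ∀ {s t m} (J : ElementaryInterval b s) → Vol J ≡ (b ^ t) /ᵇ m → t + sum (d J) ≡ m
  Vol≡b^t/b^m⇒t+d≡m {t = t} {m} J vol = ^-injectiveʳ b (nonTrivial⇒n>1 b) (begin
    b ^ (t + sum (d J))      ≡⟨ ℕ.^-distribˡ-+-* b t (sum (d J)) ⟩
    b ^ t * b ^ sum (d J)    ≡⟨ /ᵇ-cross⁻¹ 1 (b ^ t) (sum (d J)) m (trans (sym (Vol≡ J)) vol) ⟨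
    1 * b ^ m                ≡⟨ ℕ.*-identityˡ (b ^ m) ⟩
    b ^ m                    ∎)
    where open ≡-Reasoning

proposition1 : (b : ℕ) .{{_ : NonTrivial b}} (s u m : ℕ) → 1 ≤ s → u ≤ m →
    (e : Vector ℕ s) → (∀ i → 1 ≤ e i) →
    (P : PointSet (b ^ m) s) → IsUNet b u m e P →
    IsTNet b ((u + sum (λ i → e i ∸ 1)) ⊓ m) m P
proposition1 b s u m 1≤s u≤m e 1≤e P net = record
  { t≤m             = ℕ.m⊓n≤n v m
  ; inUnitCube      = IsUNet.inUnitCube net
  ; equidistributed = equidistributed
  }
  where
  v = u + sum (λ i → e i ∸ 1)

  equidistributed : (J : ElementaryInterval b s) → Vol J ≡ (b /b^ (b ^ (v ⊓ m))) m → Count b J P (b ^ (v ⊓ m))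
  equidistributed J vol with ℕ.≤-total v m
  -- The rounding amounts add up to at most the sum of the `e i ∸ 1`, which is what `v` allows
  -- beyond `u`.
  ... | inj₁ v≤m = count-roundable b net J (λ i → proj₁ (c i)) (v ⊓ m)
          (λ i → proj₁ (proj₂ (c i)))
          (ℕ.≤-trans (ℕ.+-monoʳ-≤ u (sum-mono-≤ (λ i → proj₂ (proj₂ (c i)))))
                     (ℕ.≤-reflexive (sym (ℕ.m≤n⇒m⊓n≡m v≤m))))
          (Vol≡b^t/b^m⇒t+d≡m b J vol)
    where
    c = λ i → round-up (d J i) (e i) (1≤e i)
  -- Now `v ⊓ m` is `m`, so every `d J i` is 0 and already divisible by `e i`. With zero rounding
  -- the required bound is just `u ≤ m`.
  ... | inj₂ m≤v = count-roundable b net J (λ _ → 0) (v ⊓ m)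
          (λ i → subst (e i ∣_) (sym (trans (ℕ.+-identityʳ (d J i)) (sum≡0⇒≡0 (d J) d≡0 i))) (e i ∣0))
          (subst₂ _≤_ (sym (trans (cong (λ z → u + z) (sum-replicate-zero s)) (ℕ.+-identityʳ u))) (sym v⊓m≡m) u≤m)
          t+d≡m
    where
    v⊓m≡m = ℕ.m≥n⇒m⊓n≡n m≤v
    t+d≡m = Vol≡b^t/b^m⇒t+d≡m b J vol
    d≡0 : sum (d J) ≡ 0
    d≡0 = ℕ.+-cancelˡ-≡ m _ _ (trans (cong (_+ sum (d J)) (sym v⊓m≡m)) (trans t+d≡m (sym (ℕ.+-identityʳ m))))
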